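{- Let $G$ be a finite simple graph that is $(P_3\cup P_2,K_4)$-free. Let $D_1=\{x\in V(G): \omega(G-N(x))\le 2\}$. If the induced subgraph $G[D_1]$ contains an induced subgraph isomorphic to $P_2\cup P_1$, then $\chi(G)\le 7$.
   Context: $P_n$ is the path on $n$ vertices, $K_4$ the complete graph on $4$ vertices, $\cup$ disjoint union. "Free"/"contains" refer to induced subgraphs. $N(x)$ is the (open) neighborhood of $x$, and $G-N(x)$ is the subgraph induced by $V(G)\setminus N(x)$. $\omega$ denotes clique number and $\chi$ chromatic number. -}

module Defs where

open import Data.Bool using (true; false)
open import Data.Fin using (Fin; zero; suc; toℕ; splitAt; finToFun; funToFin)
open import Data.Fin.Properties using (all?; any?; finToFun-funToFin) renaming (_≟_ to _≟ᶠ_)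
open import Data.Fin.Subset using (Subset; _∈_; ∣_∣; ∁; ⊥)
open import Data.Fin.Subset.Properties using (_∈?_; anySubset?; ∣p∣≤n; ∣⊥∣≡0; ∉⊥)
open import Data.Nat using (ℕ; zero; suc; _+_; _^_; _≤_; _≤?_; z≤n; s≤s; _≤′_; ≤′-refl; ≤′-step)
open import Data.Nat.Properties using (1+n≢n; ≤⇒≤′; ≤′⇒≤) renaming (_≟_ to _≟ⁿ_)
open import Data.Product using (Σ; ∃; ∃-syntax; _×_; _,_; proj₁)
open import Data.Sum.Relation.Binary.Pointwise using (Pointwise; inj₁; inj₂; ⊎-symmetric; ⊎-decidable)
open import Data.Sum using (_⊎_; inj₁; inj₂)
open import Data.Vec using (_∷_; tabulate)
open import Function using (_∘_; _on_; _⇔_; _↔_; Inverse)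
open import Level using (0ℓ)
open import Relation.Binary using (Rel; Symmetric; Irreflexive) renaming (Decidable to Decidable₂)
open import Relation.Binary.Construct.Closure.Symmetric using (SymClosure; fwd; bwd) renaming (symmetric to SymClosure-sym)
open import Relation.Binary.PropositionalEquality using (_≡_; _≢_; refl; sym; trans; cong)
open import Relation.Nullary using (Dec; yes; no; does; ¬_; contradiction)
open import Relation.Nullary.Decidable using (map′; _×-dec_; _⊎-dec_; _→-dec_; ¬?)
open import Relation.Unary using (Pred; Decidable)

private
  variable
    m n k : ℕ

-- Adjacency is decidable so that the clique number and the chromatic number
-- below exist as natural numbers constructively.
record Graph (n : ℕ) : Set₁ where
  field
    Adj    : Rel (Fin n) 0ℓ
    symm   : Symmetric Adj
    irrefl : Irreflexive _≡_ Adj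
    adj?   : Decidable₂ Adj

open Graph public

P : (n : ℕ) → Graph n
P n = record
  { Adj    = SymClosure Next
  ; symm   = SymClosure-sym Next
  ; irrefl = λ { refl (fwd e) → 1+n≢n e ; refl (bwd e) → 1+n≢n e }
  ; adj?   = λ i j → map′ (λ { (inj₁ e) → fwd e ; (inj₂ e) → bwd e })
                          (λ { (fwd e) → inj₁ e ; (bwd e) → inj₂ e })
                          ((suc (toℕ i) ≟ⁿ toℕ j) ⊎-dec (suc (toℕ j) ≟ⁿ toℕ i))
  }
  where
  Next : Rel (Fin n) 0ℓ
  Next i j = suc (toℕ i) ≡ toℕ j

K : (n : ℕ) → Graph n
K n = record
  { Adj    = _≢_
  ; symm   = λ i≢j → i≢j ∘ sym
  ; irrefl = λ i≡j i≢j → i≢j i≡j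
  ; adj?   = λ i j → ¬? (i ≟ᶠ j)
  }

infixr 6 _∪ᵍ_

_∪ᵍ_ : Graph m → Graph n → Graph (m + n)
_∪ᵍ_ {m} G H = record
  { Adj    = Pointwise (Adj G) (Adj H) on splitAt m
  ; symm   = ⊎-symmetric (symm G) (symm H)
  ; irrefl = λ { refl → irr _ }
  ; adj?   = λ i j → ⊎-decidable (adj? G) (adj? H) (splitAt m i) (splitAt m j)
  }
  where
  irr : ∀ x → ¬ Pointwise (Adj G) (Adj H) x x
  irr _ (inj₁ a) = irrefl G refl a
  irr _ (inj₂ a) = irrefl H refl a

-- The increasing enumeration of the elements of a subset.
enum : (S : Subset n) → Fin ∣ S ∣ → Fin n
enum (true  ∷ S) zero    = zero
enum (true  ∷ S) (suc i) = suc (enum S i)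
enum (false ∷ S) i       = suc (enum S i)

infixl 8 _[_]

-- The vertices of G [ S ] are relabelled along enum S, which is injective.
_[_] : Graph n → (S : Subset n) → Graph ∣ S ∣
G [ S ] = record
  { Adj    = Adj G on enum S
  ; symm   = symm G
  ; irrefl = λ { refl → irrefl G refl }
  ; adj?   = λ i j → adj? G (enum S i) (enum S j)
  }

infix 4 _≅_

_≅_ : Graph m → Graph n → Set
_≅_ {m} {n} G H =
  Σ (Fin m ↔ Fin n) λ φ → let open Inverse φ in
    ∀ i j → Adj G i j ⇔ Adj H (to i) (to j)

Contains : Graph n → Graph m → Set
Contains G H = ∃[ S ] G [ S ] ≅ H

Free : Graph m → Graph n → Set
Free H G = ¬ Contains G H

⟪_⟫ : {Q : Pred (Fin n) 0ℓ} → Decidable Q → Subset n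
⟪ Q? ⟫ = tabulate (does ∘ Q?)

N : (G : Graph n) → Fin n → Subset n
N G x = ⟪ adj? G x ⟫

_─N_ : (G : Graph n) (x : Fin n) → Graph ∣ ∁ (N G x) ∣
G ─N x = G [ ∁ (N G x) ]

IsMaximum IsMinimum : Pred ℕ 0ℓ → Pred ℕ 0ℓ
IsMaximum Q k = Q k × (∀ j → Q j → j ≤ k)
IsMinimum Q k = Q k × (∀ j → Q j → k ≤ j)

maximum : {Q : Pred ℕ 0ℓ} → Decidable Q → Q 0 →
          ∀ b → (∀ j → Q j → j ≤ b) → ∃ (IsMaximum Q)
maximum Q? q₀ zero    bnd = zero , q₀ , bnd
maximum {Q} Q? q₀ (suc b) bnd with Q? (suc b)
... | yes q = suc b , q , bnd
... | no ¬q = maximum Q? q₀ b λ j q → below q (≤⇒≤′ (bnd j q))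
  where
  below : ∀ {j} → Q j → j ≤′ suc b → j ≤ b
  below q ≤′-refl       = contradiction q ¬q
  below q (≤′-step j≤b) = ≤′⇒≤ j≤b

minimum : {Q : Pred ℕ 0ℓ} → Decidable Q → ∀ b → Q b → ∃ (IsMinimum Q)
minimum Q? zero    q = zero , q , λ _ _ → z≤n
minimum {Q} Q? (suc b) q with Q? 0
... | yes q₀ = zero , q₀ , λ _ _ → z≤n
... | no ¬q₀ with minimum (Q? ∘ suc) b q
...   | k , qₖ , least = suc k , qₖ , above
  where
  above : ∀ j → Q j → suc k ≤ j
  above zero    q₀ = contradiction q₀ ¬q₀
  above (suc j) qⱼ = s≤s (least j qⱼ)

IsClique : Graph n → Subset n → Set
IsClique G S = ∀ i j → i ∈ S → j ∈ S → i ≢ j → Adj G i j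

isClique? : (G : Graph n) → Decidable (IsClique G)
isClique? G S = all? λ i → all? λ j →
  (i ∈? S) →-dec ((j ∈? S) →-dec (¬? (i ≟ᶠ j) →-dec adj? G i j))

HasClique : Graph n → ℕ → Set
HasClique G k = ∃[ S ] IsClique G S × ∣ S ∣ ≡ k

hasClique? : (G : Graph n) → Decidable (HasClique G)
hasClique? G k = anySubset? λ S → isClique? G S ×-dec (∣ S ∣ ≟ⁿ k)

cliqueNumber : (G : Graph n) → ∃ (IsMaximum (HasClique G))
cliqueNumber {n} G = maximum (hasClique? G)
  (⊥ , (λ _ _ i∈⊥ → contradiction i∈⊥ ∉⊥) , ∣⊥∣≡0 n)
  n (λ { _ (S , _ , refl) → ∣p∣≤n S })

ω : Graph n → ℕ
ω = proj₁ ∘ cliqueNumber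

IsColouring : (G : Graph n) → (Fin n → Fin k) → Set
IsColouring G c = ∀ i j → Adj G i j → c i ≢ c j

isColouring? : (G : Graph n) (c : Fin n → Fin k) → Dec (IsColouring G c)
isColouring? G c = all? λ i → all? λ j → adj? G i j →-dec ¬? (c i ≟ᶠ c j)

Colourable : Graph n → ℕ → Set
Colourable {n} G k = Σ (Fin n → Fin k) (IsColouring G)

colourable? : (G : Graph n) → Decidable (Colourable G)
colourable? {n} G k = map′
  (λ (t , p) → finToFun t , p)
  (λ (c , p) → funToFin c , λ i j a e →
     p i j a (trans (sym (finToFun-funToFin c i)) (trans e (finToFun-funToFin c j))))
  (any? {k ^ n} λ t → isColouring? G (finToFun t))

chromaticNumber : (G : Graph n) → ∃ (IsMinimum (Colourable G))
chromaticNumber {n} G =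
  minimum (colourable? G) n ((λ i → i) , λ i j a i≡j → irrefl G i≡j a)

χ : Graph n → ℕ
χ = proj₁ ∘ chromaticNumber

D₁ : Graph n → Subset n
D₁ G = ⟪ (λ x → ω (G ─N x) ≤? 2) ⟫

module Submission where

-- Let a ~ b and c be the vertices of an induced P₂ ∪ P₁ in D₁.  The
-- non-neighbours of each of a, b, c span no triangle.  Hence N(a) − N(c) and
-- N(b) − N(c) are independent, since a and b lie outside N(c), and likewise
-- N(c) − N(a) and N(c) − N(b), since c lies outside N(a) and N(b).  The common
-- neighbours of a, b and c are independent because G is K₄-free.  The
-- remaining vertices are adjacent to none of a, b, c: an induced P₃ among them
-- would form P₃ ∪ P₂ with ab, so they have degree at most one among themselves
-- and need two more colours.

open import Defs
open import Data.Bool using (if_then_else_; true; false)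
open import Data.Empty using (⊥; ⊥-elim)
open import Data.Fin using (Fin; zero; suc; _<_)
open import Data.Fin.Patterns using (0F; 1F; 2F; 3F; 4F; 5F; 6F)
open import Data.Fin.Permutation using (↔⇒≡)
open import Data.Fin.Properties using (any?; <-cmp; <-asym; _<?_; suc-injective)
  renaming (_≟_ to _≟ᶠ_)
open import Data.Fin.Subset using (Subset; _∈_; ∣_∣; ∁)
open import Data.Fin.Subset.Properties using (x∉p⇒x∈∁p)
open import Data.Nat using (ℕ; _≤_; _≤?_)
open import Data.Nat.Properties using (≤-refl; ≤-trans; <⇒≱)
open import Data.Product using (∃; ∃-syntax; _×_; _,_; proj₁; proj₂)
open import Data.Sum.Relation.Binary.Pointwise using (inj₁)
open import Data.Vec using ([]; _∷_; lookup; tabulate; allFin; here; there)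
open import Data.Vec.Properties using (lookup∘tabulate; lookup⇒[]=; []=⇒lookup)
open import Data.Vec.Relation.Unary.All using ([]; _∷_)
import Data.Vec.Relation.Unary.All.Properties as All
open import Data.Vec.Relation.Unary.AllPairs as AllPairs using (AllPairs; []; _∷_)
open import Function using (_∘_; id; _⇔_; mk⇔; mk↔ₛ′; Equivalence; Inverse)
open import Level using (0ℓ)
open import Relation.Binary using (Rel; Symmetric; tri<; tri≈; tri>)
open import Relation.Binary.Construct.Closure.Symmetric using (fwd)
open import Relation.Binary.PropositionalEquality
  using (_≡_; _≢_; refl; sym; trans; cong; subst; subst₂)
open import Relation.Nullary using (yes; no; does; ¬_; contradiction)
open import Relation.Nullary.Decidable using (dec-true; _×-dec_; ¬?)
open import Relation.Unary using (Pred; Decidable)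

private
  variable
    m n k : ℕ

-- Subsets cut out by decidable predicates, and their enumerations.

∈⟪⟫⁺ : {Q : Pred (Fin n) 0ℓ} (Q? : Decidable Q) {x : Fin n} → Q x → x ∈ ⟪ Q? ⟫
∈⟪⟫⁺ Q? {x} q = lookup⇒[]= x _ (trans (lookup∘tabulate _ x) (dec-true (Q? x) q))

∈⟪⟫⁻ : {Q : Pred (Fin n) 0ℓ} (Q? : Decidable Q) {x : Fin n} → x ∈ ⟪ Q? ⟫ → Q x
∈⟪⟫⁻ Q? {x} x∈ with Q? x | trans (sym (lookup∘tabulate (does ∘ Q?) x)) ([]=⇒lookup x∈)
... | yes q | _  = q
... | no _  | ()

enum-∈ : (S : Subset n) (i : Fin ∣ S ∣) → enum S i ∈ S
enum-∈ (true  ∷ S) zero    = here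
enum-∈ (true  ∷ S) (suc i) = there (enum-∈ S i)
enum-∈ (false ∷ S) i       = there (enum-∈ S i)

enum-injective : (S : Subset n) {i j : Fin ∣ S ∣} → enum S i ≡ enum S j → i ≡ j
enum-injective (true  ∷ S) {zero}  {zero}  _ = refl
enum-injective (true  ∷ S) {suc i} {suc j} e = cong suc (enum-injective S (suc-injective e))
enum-injective (false ∷ S)                 e = enum-injective S (suc-injective e)

enum-surjective : (S : Subset n) {x : Fin n} → x ∈ S → ∃[ i ] enum S i ≡ x
enum-surjective (true  ∷ S) here       = zero , refl
enum-surjective (true  ∷ S) (there x∈) with enum-surjective S x∈
... | i , refl = suc i , refl
enum-surjective (false ∷ S) (there x∈) with enum-surjective S x∈
... | i , refl = i , refl

-- Induced copies given by vertex maps.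

Agree : Graph m → Graph n → (Fin m → Fin n) → Rel (Fin m) 0ℓ
Agree H G f i j = f i ≢ f j × (Adj H i j ⇔ Adj G (f i) (f j))

Agree-sym : (H : Graph m) (G : Graph n) (f : Fin m → Fin n) → Symmetric (Agree H G f)
Agree-sym H G f (≢ , iff) = ≢ ∘ sym , mk⇔ (symm G ∘ to ∘ symm H) (symm H ∘ from ∘ symm G)
  where open Equivalence iff

-- Injectivity of `f` is contained in `Agree`. On equal indices irreflexivity makes both adjacencies
-- empty.
IsInducedCopy : Graph m → Graph n → (Fin m → Fin n) → Set
IsInducedCopy H G f = ∀ {i j} → i ≢ j → Agree H G f i j

-- The subset is the image of `f`; the isomorphism sends a position in its enumeration to the
-- preimage of the vertex found there.
inducedCopy⇒contains : (H : Graph m) (G : Graph n) (f : Fin m → Fin n) →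
                       IsInducedCopy H G f → Contains G H
inducedCopy⇒contains {m} H G f copy =
  S , mk↔ₛ′ to from
        (λ i → f-injective (trans (f∘to _) (enum∘from i)))
        (λ k → enum-injective S (trans (enum∘from _) (f∘to k)))
    , λ i j → subst₂ (λ x y → Adj G x y ⇔ Adj H (to i) (to j))
                     (f∘to i) (f∘to j) (adj⇔ (to i) (to j))
  where
  inImage? : Decidable (λ x → ∃[ i ] f i ≡ x)
  inImage? x = any? λ i → f i ≟ᶠ x

  S = ⟪ inImage? ⟫

  preimage : ∀ k → ∃[ i ] f i ≡ enum S k
  preimage k = ∈⟪⟫⁻ inImage? (enum-∈ S k)

  position : ∀ i → ∃[ k ] enum S k ≡ f i
  position i = enum-surjective S (∈⟪⟫⁺ inImage? (i , refl))

  to        = proj₁ ∘ preimage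
  f∘to      = proj₂ ∘ preimage
  from      = proj₁ ∘ position
  enum∘from = proj₂ ∘ position

  f-injective : ∀ {i j} → f i ≡ f j → i ≡ j
  f-injective {i} {j} e with i ≟ᶠ j
  ... | yes i≡j = i≡j
  ... | no  i≢j = contradiction e (proj₁ (copy i≢j))

  adj⇔ : ∀ i j → Adj G (f i) (f j) ⇔ Adj H i j
  adj⇔ i j with i ≟ᶠ j
  ... | yes refl = mk⇔ (λ e → contradiction e (irrefl G refl))
                       (λ e → contradiction e (irrefl H refl))
  ... | no  i≢j  = mk⇔ (Equivalence.from iff) (Equivalence.to iff)
    where iff = proj₂ (copy i≢j)

-- Replaces each `f i` by its position in `enum S`. This carries a triangle of `G` over to the
-- relabelled graph `G ─N x`.
inducedCopy-restrict : (H : Graph m) (G : Graph n) (S : Subset n) (f : Fin m → Fin n) →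
                       IsInducedCopy H G f → (∀ i → f i ∈ S) →
                       ∃ (IsInducedCopy H (G [ S ]))
inducedCopy-restrict H G S f copy f∈ =
  proj₁ ∘ position , λ {i} {j} i≢j →
    let ≢ , iff = copy i≢j in
    (λ e → ≢ (trans (sym (enum∘ i)) (trans (cong (enum S) e) (enum∘ j)))) ,
    subst₂ (λ x y → Adj H i j ⇔ Adj G x y) (sym (enum∘ i)) (sym (enum∘ j)) iff
  where
  position : ∀ i → ∃[ k ] enum S k ≡ f i
  position i = enum-surjective S (f∈ i)
  enum∘ = proj₂ ∘ position

-- Stated through does so that, for concrete H, i and j, it computes to the
-- condition required of f i and f j.
Match : Graph m → Graph n → (Fin m → Fin n) → Rel (Fin m) 0ℓ
Match H G f i j =
  if does (adj? H i j) then Adj G (f i) (f j) else (f i ≢ f j × ¬ Adj G (f i) (f j))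

match⇒agree : (H : Graph m) (G : Graph n) (f : Fin m → Fin n) {i j : Fin m} →
              Match H G f i j → Agree H G f i j
match⇒agree H G f {i} {j} match with adj? H i j
... | yes h = (λ e → irrefl G e match) , mk⇔ (λ _ → match) (λ _ → h)
... | no ¬h = proj₁ match , mk⇔ (λ h → contradiction h ¬h) (λ g → contradiction g (proj₂ match))

allPairs-tabulate⁻ : {A : Set} {R : Rel A 0ℓ} → Symmetric R → (g : Fin n → A) →
                     AllPairs R (tabulate g) → ∀ {i j} → i ≢ j → R (g i) (g j)
allPairs-tabulate⁻ R-sym g (x∼ ∷ _)  {zero}  {zero}  i≢j = contradiction refl i≢j
allPairs-tabulate⁻ R-sym g (x∼ ∷ _)  {zero}  {suc j} _   = All.tabulate⁻ x∼ j
allPairs-tabulate⁻ R-sym g (x∼ ∷ _)  {suc i} {zero}  _   = R-sym (All.tabulate⁻ x∼ i)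
allPairs-tabulate⁻ R-sym g (_  ∷ ps) {suc i} {suc j} i≢j =
  allPairs-tabulate⁻ R-sym (g ∘ suc) ps (i≢j ∘ cong suc)

-- `Agree` is symmetric, so the pairs above the diagonal suffice: a concrete copy is certified by
-- listing them row by row.
matches⇒inducedCopy : (H : Graph m) (G : Graph n) (f : Fin m → Fin n) →
                      AllPairs (Match H G f) (allFin m) → IsInducedCopy H G f
matches⇒inducedCopy H G f ps =
  allPairs-tabulate⁻ (Agree-sym H G f) id (AllPairs.map (match⇒agree H G f) ps)

-- Distinct vertices of `S` have distinct images under the bijection, and distinctness is adjacency
-- in `K k`.
contains⇒hasClique : (G : Graph n) → Contains G (K k) → HasClique G k
contains⇒hasClique G (S , φ , iff) = S , clique , ↔⇒≡ φ
  where
  open Inverse φ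
  clique : IsClique G S
  clique x y x∈ y∈ x≢y with enum-surjective S x∈ | enum-surjective S y∈
  ... | i , refl | j , refl =
    Equivalence.from (iff i j) λ e → x≢y (cong (enum S)
      (trans (sym (strictlyInverseʳ i)) (trans (cong from e) (strictlyInverseʳ j))))

contains⇒adj-embedding : {H : Graph m} {G : Graph n} → Contains G H →
  ∃[ f ] ∀ i j → Adj H i j ⇔ Adj G (f i) (f j)
contains⇒adj-embedding {H = H} {G} (S , φ , iff) = enum S ∘ from , λ i j →
  let open Equivalence (iff (from i) (from j))
        renaming (to to adj⇒; from to adj⇐) in
  mk⇔ (λ h → adj⇐ (subst₂ (Adj H) (sym (strictlyInverseˡ i)) (sym (strictlyInverseˡ j)) h))
      (λ g → subst₂ (Adj H) (strictlyInverseˡ i) (strictlyInverseˡ j) (adj⇒ g))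
  where open Inverse φ

-- Consequences of the forbidden configurations.

-- The triangle would be a 3-clique of `G ─N x`, whose clique number is at most 2. For a fixed
-- non-neighbour `u` of `x`, this makes N(u) - N(x) independent.
D₁-triangle-free : (G : Graph n) {x u v w : Fin n} → x ∈ D₁ G →
  ¬ Adj G x u → ¬ Adj G x v → ¬ Adj G x w →
  Adj G u v → Adj G u w → ¬ Adj G v w
D₁-triangle-free G {x} {u} {v} {w} x∈ xu xv xw uv uw vw =
  contradiction (≤-trans (proj₂ (proj₂ (cliqueNumber (G ─N x))) 3 hasTriangle)
                         (∈⟪⟫⁻ (λ y → ω (G ─N y) ≤? 2) x∈))
                (<⇒≱ ≤-refl)
  where
  f : Fin 3 → Fin _
  f = lookup (u ∷ v ∷ w ∷ [])

  f∈ : ∀ i → f i ∈ ∁ (N G x)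
  f∈ 0F = x∉p⇒x∈∁p (xu ∘ ∈⟪⟫⁻ (adj? G x))
  f∈ 1F = x∉p⇒x∈∁p (xv ∘ ∈⟪⟫⁻ (adj? G x))
  f∈ 2F = x∉p⇒x∈∁p (xw ∘ ∈⟪⟫⁻ (adj? G x))

  triangle : IsInducedCopy (K 3) G f
  triangle = matches⇒inducedCopy (K 3) G f ((uv ∷ uw ∷ []) ∷ (vw ∷ []) ∷ [] ∷ [])

  hasTriangle : HasClique (G ─N x) 3
  hasTriangle =
    let g , copy = inducedCopy-restrict (K 3) G (∁ (N G x)) f triangle f∈ in
    contains⇒hasClique (G ─N x) (inducedCopy⇒contains (K 3) (G ─N x) g copy)

-- For a fixed edge `t u`, this makes the common neighbours of its ends independent.
K₄-free⇒ : (G : Graph n) → Free (K 4) G → ∀ {t u v w} →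
  Adj G t u → Adj G t v → Adj G t w → Adj G u v → Adj G u w → ¬ Adj G v w
K₄-free⇒ G free {t} {u} {v} {w} tu tv tw uv uw vw =
  free (inducedCopy⇒contains (K 4) G f (matches⇒inducedCopy (K 4) G f
    ((tu ∷ tv ∷ tw ∷ []) ∷ (uv ∷ uw ∷ []) ∷ (vw ∷ []) ∷ [] ∷ [])))
  where f = lookup (t ∷ u ∷ v ∷ w ∷ [])

P₃∪P₂-free⇒ : (G : Graph n) → Free (P 3 ∪ᵍ P 2) G → ∀ {u v w a b} →
  Adj G u v → Adj G v w → u ≢ w → ¬ Adj G u w → Adj G a b →
  ¬ Adj G a u → ¬ Adj G a v → ¬ Adj G a w →
  ¬ Adj G b u → ¬ Adj G b v → ¬ Adj G b w → ⊥
P₃∪P₂-free⇒ G free {u} {v} {w} {a} {b} uv vw u≢w uw ab au av aw bu bv bw =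
  free (inducedCopy⇒contains (P 3 ∪ᵍ P 2) G f (matches⇒inducedCopy (P 3 ∪ᵍ P 2) G f
    ( (uv ∷ (u≢w , uw) ∷ off-a au bu ∷ off-b au bu ∷ [])
    ∷ (vw ∷ off-a av bv ∷ off-b av bv ∷ [])
    ∷ (off-a aw bw ∷ off-b aw bw ∷ [])
    ∷ (ab ∷ [])
    ∷ [] ∷ [])))
  where
  f = lookup (u ∷ v ∷ w ∷ a ∷ b ∷ [])

  -- Distinctness comes from non-adjacency: if `x` were `a`, it would be adjacent to `b`. The same
  -- holds for `off-b` with the roles exchanged.
  off-a : ∀ {x} → ¬ Adj G a x → ¬ Adj G b x → x ≢ a × ¬ Adj G x a
  off-a ax bx = (λ { refl → bx (symm G ab) }) , ax ∘ symm G

  off-b : ∀ {x} → ¬ Adj G a x → ¬ Adj G b x → x ≢ b × ¬ Adj G x b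
  off-b ax bx = (λ { refl → ax ab }) , bx ∘ symm G

-- The seven independent classes.

-- The classes may overlap: the colour of a vertex is the class that `cover` picks for it.
independentCover⇒colourable : (G : Graph n) (C : Fin k → Pred (Fin n) 0ℓ) →
  (∀ v → ∃[ i ] C i v) → (∀ i {u v} → C i u → C i v → ¬ Adj G u v) → Colourable G k
independentCover⇒colourable G C cover indep = proj₁ ∘ cover , λ u v uv e →
  indep _ (subst (λ i → C i u) e (proj₂ (cover u))) (proj₂ (cover v)) uv

module _ (G : Graph n) (P₃∪P₂-free : Free (P 3 ∪ᵍ P 2) G) (K₄-free : Free (K 4) G)
         {a b c : Fin n} (a∈ : a ∈ D₁ G) (b∈ : b ∈ D₁ G) (c∈ : c ∈ D₁ G)
         (ab : Adj G a b) (ac : ¬ Adj G a c) (bc : ¬ Adj G b c) where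

  private
    ca : ¬ Adj G c a
    ca = ac ∘ symm G

    cb : ¬ Adj G c b
    cb = bc ∘ symm G

    Remote : Pred (Fin n) 0ℓ
    Remote v = ¬ Adj G a v × ¬ Adj G b v × ¬ Adj G c v

    -- Suppose `u` and `w` differ. If adjacent, they form with `v` a triangle outside N(c), against
    -- `c∈`; if not, `u v w` is an induced P₃ with no edge to `a b`.
    remote-degree≤1 : ∀ {u v w} → Remote u → Remote v → Remote w →
                      Adj G v u → Adj G v w → u ≡ w
    remote-degree≤1 {u} {v} {w} (au , bu , cu) (av , bv , cv) (aw , bw , cw) vu vw
      with u ≟ᶠ w | adj? G u w
    ... | yes u≡w | _      = u≡w
    ... | no _    | yes uw = contradiction uw (D₁-triangle-free G c∈ cv cu cw vu vw)
    ... | no u≢w  | no ¬uw = ⊥-elim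
      (P₃∪P₂-free⇒ G P₃∪P₂-free (symm G vu) vw u≢w ¬uw ab au av aw bu bv bw)

    SmallerNeighbour : Pred (Fin n) 0ℓ
    SmallerNeighbour v = ∃[ u ] Remote u × Adj G v u × u < v

    remote? : Decidable Remote
    remote? v = ¬? (adj? G a v) ×-dec ¬? (adj? G b v) ×-dec ¬? (adj? G c v)

    smallerNeighbour? : Decidable SmallerNeighbour
    smallerNeighbour? v = any? λ u → remote? u ×-dec adj? G v u ×-dec (u <? v)

    -- An edge of remote vertices is a whole component, and of its two ends
    -- exactly the larger one has a smaller neighbour.
    Class : Fin 7 → Pred (Fin n) 0ℓ
    Class 0F v = ¬ Adj G c v × Adj G a v
    Class 1F v = ¬ Adj G c v × Adj G b v
    Class 2F v = Remote v × ¬ SmallerNeighbour v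
    Class 3F v = Remote v × SmallerNeighbour v
    Class 4F v = Adj G c v × ¬ Adj G a v
    Class 5F v = Adj G c v × ¬ Adj G b v
    Class 6F v = Adj G a v × Adj G b v × Adj G c v

    cover : ∀ v → ∃[ i ] Class i v
    cover v with adj? G a v | adj? G b v | adj? G c v
    ... | yes av | yes bv | yes cv = 6F , av , bv , cv
    ... | no ¬av | _      | yes cv = 4F , cv , ¬av
    ... | yes _  | no ¬bv | yes cv = 5F , cv , ¬bv
    ... | yes av | _      | no ¬cv = 0F , ¬cv , av
    ... | no _   | yes bv | no ¬cv = 1F , ¬cv , bv
    ... | no ¬av | no ¬bv | no ¬cv with smallerNeighbour? v
    ...   | yes s = 3F , (¬av , ¬bv , ¬cv) , s
    ...   | no ¬s = 2F , (¬av , ¬bv , ¬cv) , ¬s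

    -- The smaller neighbour of `u` and the vertex `v` are both remote neighbours of `u`, hence
    -- equal, which would put `v` below `u`.
    both-smaller : ∀ {u v} → Remote u → Remote v → SmallerNeighbour u → u < v → ¬ Adj G u v
    both-smaller ru rv (w , rw , uw , w<u) u<v uv
      with refl ← remote-degree≤1 rw ru rv uw uv = <-asym w<u u<v

    independent : ∀ i {u v} → Class i u → Class i v → ¬ Adj G u v
    independent 0F (cu , au) (cv , av) = D₁-triangle-free G c∈ ca cu cv au av
    independent 1F (cu , bu) (cv , bv) = D₁-triangle-free G c∈ cb cu cv bu bv
    -- The smaller end of an edge would be a smaller neighbour of the larger end.
    independent 2F {u} {v} (ru , ¬su) (rv , ¬sv) uv with <-cmp u v
    ... | tri< u<v _ _  = ¬sv (u , ru , symm G uv , u<v)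
    ... | tri≈ _ refl _ = irrefl G refl uv
    ... | tri> _ _ v<u  = ¬su (v , rv , uv , v<u)
    independent 3F {u} {v} (ru , su) (rv , sv) uv with <-cmp u v
    ... | tri< u<v _ _  = both-smaller ru rv su u<v uv
    ... | tri≈ _ refl _ = irrefl G refl uv
    ... | tri> _ _ v<u  = both-smaller rv ru sv v<u (symm G uv)
    independent 4F (cu , au) (cv , av) = D₁-triangle-free G a∈ ac au av cu cv
    independent 5F (cu , bu) (cv , bv) = D₁-triangle-free G b∈ bc bu bv cu cv
    independent 6F (au , bu , _) (av , bv , _) = K₄-free⇒ G K₄-free ab au av bu bv

  colourable-7 : Colourable G 7
  colourable-7 = independentCover⇒colourable G Class cover independent

theorem1p1 : ∀ (n : ℕ) (G : Graph n) →
    Free (P 3 ∪ᵍ P 2) G → Free (K 4) G →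
    Contains (G [ D₁ G ]) (P 2 ∪ᵍ P 1) →
    χ G ≤ 7
theorem1p1 n G free₁ free₂ contains
  with f , iff ← contains⇒adj-embedding {H = P 2 ∪ᵍ P 1} {G [ D₁ G ]} contains =
  proj₂ (proj₂ (chromaticNumber G)) 7
    (colourable-7 G free₁ free₂ (enum-∈ _ (f 0F)) (enum-∈ _ (f 1F)) (enum-∈ _ (f 2F))
      -- In `P 2 ∪ᵍ P 1` the edge is `0F 1F` and the lone vertex is `2F`; no constructor of
      -- `Pointwise` relates the two summands, so `λ ()` refutes adjacency across them.
      (Equivalence.to (iff 0F 1F) (inj₁ (fwd refl)))
      ((λ ()) ∘ Equivalence.from (iff 0F 2F))
      ((λ ()) ∘ Equivalence.from (iff 1F 2F)))
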